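{- For all positive integers $m,n$, the diameter of the cyclic simplicial rook graph satisfies $\operatorname{diam}(\mathcal{CSR}(m,n))=m-\left\lfloor \frac{m-1}{n}\right\rfloor-1$.
   Context: For positive integers $m,n$, the cyclic simplicial rook graph $\mathcal{CSR}(m,n)$ is the graph whose vertices are the vectors $(a_1,\dots,a_m)\in\mathbb{Z}_n^m$ with $a_1+\cdots+a_m\equiv 0 \pmod n$, two vertices being adjacent if and only if their vectors differ in exactly two coordinates. -}

module Defs where

open import Data.Fin using (Fin; toℕ)
open import Data.Nat using (ℕ; zero; suc; _≤_)
open import Data.Nat.Divisibility using (_∣_)
open import Data.Product using (_×_; _,_; ∃-syntax)
open import Data.Refinement using (Refinement; value)
open import Data.Sum using (_⊎_; inj₁)
open import Data.Vec using (Vec; lookup; map; sum)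
open import Function using (_∘_; _⇔_; mk⇔; Equivalence)
open import Relation.Binary using (Rel; Symmetric)
open import Relation.Binary.PropositionalEquality using (_≡_; _≢_; refl; ≢-sym)
open import Relation.Nullary using (¬_)
open import Level using (0ℓ)

record Graph : Set₁ where
  field
    Vertex      : Set
    Adjacent    : Rel Vertex 0ℓ
    symmetric   : Symmetric Adjacent
    irreflexive : ∀ {u} → ¬ Adjacent u u

module _ (G : Graph) where
  open Graph G

  data Walk : Vertex → Vertex → ℕ → Set where
    []  : ∀ {u} → Walk u u zero
    _∷_ : ∀ {u v w k} → Adjacent u v → Walk v w k → Walk u w (suc k)

  -- A walk of least length is a path, so this is the usual graph distance.
  IsDistance : Vertex → Vertex → ℕ → Set
  IsDistance u v d = Walk u v d × (∀ k → Walk u v k → d ≤ k)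

  -- The maximum of all distances; in particular every pair of vertices is
  -- required to have a (finite) distance, so G is connected.
  IsDiameter : ℕ → Set
  IsDiameter D = (∀ u v → ∃[ d ] (IsDistance u v d × d ≤ D))
               × (∃[ u ] ∃[ v ] IsDistance u v D)

-- The set of coordinates in which a and b differ is {i , j} with i ≢ j.
DifferInExactlyTwo : ∀ {A : Set} {m} → Rel (Vec A m) 0ℓ
DifferInExactlyTwo a b =
  ∃[ i ] ∃[ j ] (i ≢ j × (∀ k → (lookup a k ≢ lookup b k) ⇔ (k ≡ i ⊎ k ≡ j)))

-- ℤₙ is represented by the residues Fin n.  The proof component of a
-- refinement is irrelevant, so vertices are equal when their vectors are.
CSRVertex : ℕ → ℕ → Set
CSRVertex m n = Refinement (Vec (Fin n) m) (λ a → n ∣ sum (map toℕ a))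

CSR : ℕ → ℕ → Graph
CSR m n = record
  { Vertex      = CSRVertex m n
  ; Adjacent    = λ u v → DifferInExactlyTwo (value u) (value v)
  ; symmetric   = λ (i , j , i≢j , eqv) → i , j , i≢j , λ k →
      mk⇔ (Equivalence.to (eqv k) ∘ ≢-sym) (≢-sym ∘ Equivalence.from (eqv k))
  ; irreflexive = λ (i , _ , _ , eqv) → Equivalence.from (eqv i) (inj₁ refl) refl
  }

{-# OPTIONS --safe #-}
module Submission where

-- Upper bound: carry the difference of two vertices around the cycle of coordinates. Once
-- the carry t across one edge of the cycle is fixed, all carries are forced, and each of
-- the m edges has exactly one t for which nothing crosses it. Hence some t leaves at least
-- m/n edges unused, and every used edge costs one step.
-- Lower bound: on each connected component of the graph of coordinate pairs changed by a
-- walk, the difference of the end points sums to 0. For the difference (z , 1 , … , 1)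
-- every component but one has at least n elements, so there are at most
-- ⌊(m - 1)/n⌋ + 1 components, whereas k steps leave at least m - k of them.

open import Defs
open import Data.Bool using (if_then_else_)
open import Data.Fin using (Fin; zero; suc; toℕ; fromℕ; punchOut; punchIn; _≟_)
open import Data.Fin.Properties
  using (toℕ-injective; toℕ<n; toℕ-fromℕ<; any?; all?; punchInᵢ≢i; punchOut-punchIn; punchOut-cong)
open import Data.Irrelevant using ([_])
open import Data.Nat
  using (ℕ; zero; suc; NonZero; >-nonZero; _∸_; _+_; _*_; _≤_; _<_; z≤n; s≤s; _≤?_)
open import Data.Nat.DivMod
  using (_/_; _%_; _mod_; m≡m%n+[m/n]*n; m<n*o⇒m/o<n; m%n<n; n/1≡n; m*n/n≡m; /-monoˡ-≤)
open import Data.Nat.Divisibility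
  using (_∣_; _∣?_; n∣m*n; ∣m+n∣m⇒∣n; ∣m∣n⇒∣m+n; ∣n⇒∣m*n; ∣⇒≤; >⇒∤; _∣0)
open import Data.Nat.Properties hiding (_≟_; _≤?_)
open import Data.Nat.Tactic.RingSolver using (solve-∀)
open import Data.Product using (_×_; _,_; proj₁; proj₂; ∃; ∃-syntax)
open import Data.Refinement using (_,_; value)
open import Data.Refinement.Properties using () renaming (_≟_ to refinement-≟)
open import Data.Sum using (_⊎_; inj₁; inj₂; [_,_]′)
open import Data.Vec using (Vec; []; _∷_; _∷ʳ_; lookup; map; replicate; initLast)
  renaming (sum to sumᵛ)
open import Data.Vec.Properties using (≡-dec; lookup-replicate)
open import Data.Vec.Relation.Binary.Pointwise.Extensional using (ext; Pointwise-≡⇒≡)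
open import Function using (_∘_; _⇔_; mk⇔; Equivalence; StrictlySurjective; case_of_)
open import Relation.Binary.PropositionalEquality
open import Relation.Nullary using (Dec; yes; no; ¬_; contradiction; does)
open import Relation.Nullary.Decidable
  using (map′; recompute; ¬?; dec-true; dec-false; _×-dec_; _⊎-dec_; _→-dec_)
open import Relation.Unary using (Decidable)

open import Algebra.Properties.Semiring.Sum +-*-semiring
  using (sum; ∑-distrib-+; ∑-comm; sum-cong-≗; *-distribˡ-sum)

-- Sums of indicators

δ : ∀ {n} → Fin n → Fin n → ℕ
δ i j = if does (i ≟ j) then 1 else 0

δ-≡ : ∀ {n} {i j : Fin n} → i ≡ j → δ i j ≡ 1
δ-≡ {i = i} {j} i≡j = cong (if_then 1 else 0) (dec-true (i ≟ j) i≡j)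

δ-≢ : ∀ {n} {i j : Fin n} → i ≢ j → δ i j ≡ 0
δ-≢ {i = i} {j} i≢j = cong (if_then 1 else 0) (dec-false (i ≟ j) i≢j)

sum-mono-≤ : ∀ {n} {f g : Fin n → ℕ} → (∀ i → f i ≤ g i) → sum f ≤ sum g
sum-mono-≤ {zero}  f≤g = z≤n
sum-mono-≤ {suc n} f≤g = +-mono-≤ (f≤g zero) (sum-mono-≤ (f≤g ∘ suc))

sum-const : ∀ n x → sum {n} (λ _ → x) ≡ n * x
sum-const zero    x = refl
sum-const (suc n) x = cong (x +_) (sum-const n x)

term≤sum : ∀ {n} (f : Fin n → ℕ) i → f i ≤ sum f
term≤sum f zero    = m≤m+n _ _
term≤sum f (suc i) = ≤-trans (term≤sum (f ∘ suc) i) (m≤n+m _ (f zero))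

sum-δ : ∀ {n} (i : Fin n) → sum (δ i) ≡ 1
sum-δ {suc n} zero    = cong suc (trans (sum-const n 0) (*-zeroʳ n))
sum-δ {suc n} (suc i) = sum-δ i

δ≤1 : ∀ {n} (i j : Fin n) → δ i j ≤ 1
δ≤1 i j = subst (δ i j ≤_) (sum-δ i) (term≤sum (δ i) j)

sum-fibres : ∀ {m n} (f : Fin m → Fin n) → sum (λ j → sum (λ i → δ (f i) j)) ≡ m
sum-fibres {m} f = begin
  sum (λ j → sum (λ i → δ (f i) j)) ≡⟨ ∑-comm (λ j i → δ (f i) j) ⟩
  sum (λ i → sum (δ (f i)))         ≡⟨ sum-cong-≗ (sum-δ ∘ f) ⟩
  sum {m} (λ _ → 1)                 ≡⟨ sum-const m 1 ⟩
  m * 1                             ≡⟨ *-identityʳ m ⟩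
  m                                 ∎
  where open ≡-Reasoning

-- Pigeonhole by summation: if every fibre had `n * fibre t < m`, the n strict inequalities would
-- add up to `n * m + n ≤ n * m`.
large-fibre : ∀ {m n} .{{_ : NonZero n}} (f : Fin m → Fin n) →
              ∃[ t ] m ≤ sum (λ i → δ (f i) t) * n
large-fibre {m} {n@(suc _)} f with any? (λ t → m ≤? sum (λ i → δ (f i) t) * n)
... | yes large = large
... | no ¬large = contradiction (begin-strict
  m * n                                       <⟨ m<m+n (m * n) {n} (s≤s z≤n) ⟩
  m * n + n                                   ≡⟨ ring m n ⟩
  n * 1 + n * m                               ≡⟨ cong₂ _+_ (sum-const n 1) (cong (n *_) (sum-fibres f)) ⟨
  sum {n} (λ _ → 1) + n * sum fibre           ≡⟨ cong (sum {n} (λ _ → 1) +_) (*-distribˡ-sum n fibre) ⟩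
  sum {n} (λ _ → 1) + sum (λ t → n * fibre t) ≡⟨ ∑-distrib-+ (λ _ → 1) (λ t → n * fibre t) ⟨
  sum (λ t → suc (n * fibre t))               ≤⟨ sum-mono-≤ small ⟩
  sum {n} (λ _ → m)                           ≡⟨ sum-const n m ⟩
  n * m                                       ≡⟨ *-comm n m ⟩
  m * n                                       ∎) (<-irrefl refl)
  where
  open ≤-Reasoning
  fibre : Fin n → ℕ
  fibre t = sum (λ i → δ (f i) t)
  small : ∀ t → n * fibre t < m
  small t = subst (_< m) (*-comm (fibre t) n) (≰⇒> (λ le → ¬large (t , le)))
  ring : ∀ m n → m * n + n ≡ n * 1 + n * m
  ring = solve-∀

-- Residues

σ : ∀ {n m} → Vec (Fin n) m → ℕ
σ a = sumᵛ (map toℕ a)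

σ-∷ʳ : ∀ {n m} (a : Vec (Fin n) m) x → σ (a ∷ʳ x) ≡ σ a + toℕ x
σ-∷ʳ []      x = +-identityʳ (toℕ x)
σ-∷ʳ (y ∷ a) x = trans (cong (toℕ y +_) (σ-∷ʳ a x)) (sym (+-assoc (toℕ y) (σ a) (toℕ x)))

-- The factor `n ∸ 1` represents -1 modulo n.
neg : ∀ {n} .{{_ : NonZero n}} → ℕ → Fin n
neg {n} s = (s * (n ∸ 1)) mod n

neg-∣ : ∀ {n} .{{_ : NonZero n}} s → n ∣ s + toℕ (neg {n} s)
neg-∣ {n@(suc n-1)} s = ∣m+n∣m⇒∣n (subst (n ∣_) (trans eq (+-comm _ (q * n))) (n∣m*n s)) (n∣m*n q)
  where
  open ≡-Reasoning
  q = s * n-1 / n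
  eq : s * n ≡ (s + toℕ (neg {n} s)) + q * n
  eq = begin
    s * suc n-1                     ≡⟨ *-suc s n-1 ⟩
    s + s * n-1                     ≡⟨ cong (s +_) (m≡m%n+[m/n]*n (s * n-1) n) ⟩
    s + (s * n-1 % n + q * n)       ≡⟨ +-assoc s _ _ ⟨
    s + s * n-1 % n + q * n         ≡⟨ cong (λ r → s + r + q * n) (toℕ-fromℕ< (m%n<n (s * n-1) n)) ⟨
    s + toℕ (neg {n} s) + q * n     ∎

-- Otherwise the gap between x and y would be a positive multiple of n smaller than n.
residue-≤ : ∀ {n} s {x y : Fin n} → n ∣ s + toℕ x → n ∣ s + toℕ y → toℕ y ≤ toℕ x
residue-≤ {n} s {x} {y} n∣x n∣y with toℕ y ≤? toℕ x
... | yes y≤x = y≤x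
... | no  y≰x with m≤n⇒∃[o]m+o≡n (≰⇒> y≰x)
...   | k , eq = contradiction (∣m+n∣m⇒∣n (subst (n ∣_) split n∣y) n∣x) (>⇒∤ k<n)
  where
  split : s + toℕ y ≡ (s + toℕ x) + suc k
  split = trans (cong (s +_) (trans (sym eq) (sym (+-suc (toℕ x) k)))) (sym (+-assoc s (toℕ x) (suc k)))
  k<n : suc k < n
  k<n = ≤-<-trans (subst (suc k ≤_) eq (s≤s (m≤n+m k (toℕ x)))) (toℕ<n y)

residue-unique : ∀ {n} s {x y : Fin n} → n ∣ s + toℕ x → n ∣ s + toℕ y → x ≡ y
residue-unique s n∣x n∣y = toℕ-injective (≤-antisym (residue-≤ s n∣y n∣x) (residue-≤ s n∣x n∣y))

-- Zero-sum vectors, up to an offset s contributed by coordinates already dropped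

ZeroSum : ∀ {n m} → ℕ → Vec (Fin n) m → Set
ZeroSum {n} s a = n ∣ s + σ a

shift : ∀ {n m} s {x : Fin n} {a : Vec (Fin n) m} → ZeroSum s (x ∷ a) → ZeroSum (s + toℕ x) a
shift {n} s {x} {a} = subst (n ∣_) (sym (+-assoc s (toℕ x) (σ a)))

unshift : ∀ {n m} s {x : Fin n} {a : Vec (Fin n) m} → ZeroSum (s + toℕ x) a → ZeroSum s (x ∷ a)
unshift {n} s {x} {a} = subst (n ∣_) (+-assoc s (toℕ x) (σ a))

lookup-ext : ∀ {A : Set} {m} {a b : Vec A m} → (∀ k → lookup a k ≡ lookup b k) → a ≡ b
lookup-ext = Pointwise-≡⇒≡ ∘ ext

head-determined : ∀ {n m} s {x y : Fin n} {a : Vec (Fin n) m} →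
                  ZeroSum s (x ∷ a) → ZeroSum s (y ∷ a) → x ≡ y
head-determined {n} s {x} {y} {a} zx zy =
  residue-unique (s + σ a) (subst (n ∣_) (swap (toℕ x)) zx) (subst (n ∣_) (swap (toℕ y)) zy)
  where
  swap : ∀ x → s + (x + σ a) ≡ s + σ a + x
  swap x = trans (cong (s +_) (+-comm x (σ a))) (sym (+-assoc s (σ a) x))

-- Coordinates before j are moved into the offset; once j is at the head, the tails coincide and the
-- zero sum fixes the entry.
agree-off-one : ∀ {n m} s {a b : Vec (Fin n) m} j → ZeroSum s a → ZeroSum s b →
                (∀ k → k ≢ j → lookup a k ≡ lookup b k) → lookup a j ≡ lookup b j
agree-off-one s {x ∷ a} {y ∷ b} zero za zb agree
  with refl ← lookup-ext {a = a} {b} (λ k → agree (suc k) (λ ())) = head-determined s {a = a} za zb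
agree-off-one s {x ∷ a} {y ∷ b} (suc j) za zb agree
  with refl ← agree zero (λ ()) =
    agree-off-one (s + toℕ x) {a} {b} j (shift s {a = a} za) (shift s {a = b} zb)
      (λ k k≢j → agree (suc k) λ { refl → k≢j refl })

AgreeOff : ∀ {A : Set} {m} (i j : Fin m) (a b : Vec A m) → Set
AgreeOff i j a b = ∀ k → k ≢ i → k ≢ j → lookup a k ≡ lookup b k

-- A single differing coordinate is excluded by `agree-off-one`, so the entries at i and j change
-- together or not at all.
agree-off-two : ∀ {n m} s {a b : Vec (Fin n) m} i j → i ≢ j → ZeroSum s a → ZeroSum s b →
                AgreeOff i j a b → a ≡ b ⊎ (DifferInExactlyTwo a b × lookup a i ≢ lookup b i)
agree-off-two s {a} {b} i j i≢j za zb agree with lookup a i ≟ lookup b i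
... | yes aᵢ≡bᵢ = inj₁ (lookup-ext eq)
  where
  eq′ : ∀ k → k ≢ j → lookup a k ≡ lookup b k
  eq′ k k≢j with k ≟ i
  ... | yes refl = aᵢ≡bᵢ
  ... | no  k≢i  = agree k k≢i k≢j
  eq : ∀ k → lookup a k ≡ lookup b k
  eq k with k ≟ j
  ... | yes refl = agree-off-one s {a} {b} j za zb eq′
  ... | no  k≢j  = eq′ k k≢j
... | no  aᵢ≢bᵢ = inj₂ ((i , j , i≢j , λ k → mk⇔ (to k) [ (λ { refl → aᵢ≢bᵢ }) , (λ { refl → aⱼ≢bⱼ }) ]′) , aᵢ≢bᵢ)
  where
  aⱼ≢bⱼ : lookup a j ≢ lookup b j
  aⱼ≢bⱼ aⱼ≡bⱼ = aᵢ≢bᵢ (agree-off-one s {a} {b} i za zb eq)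
    where
    eq : ∀ k → k ≢ i → lookup a k ≡ lookup b k
    eq k k≢i with k ≟ j
    ... | yes refl = aⱼ≡bⱼ
    ... | no  k≢j  = agree k k≢i k≢j
  to : ∀ k → lookup a k ≢ lookup b k → k ≡ i ⊎ k ≡ j
  to k ≢ with k ≟ i | k ≟ j
  ... | yes k≡i | _       = inj₁ k≡i
  ... | _       | yes k≡j = inj₂ k≡j
  ... | no  k≢i | no  k≢j = contradiction (agree k k≢i k≢j) ≢

-- The upper bound

-- The offset s lets inductions drop leading coordinates. The sum condition of the starting vector
-- is kept outside and handed to `toWalk`.
data ZeroSumWalk {n m} (s : ℕ) : Vec (Fin n) m → Vec (Fin n) m → ℕ → Set where
  []   : ∀ {a} → ZeroSumWalk s a a 0
  step : ∀ {a b c k} → DifferInExactlyTwo a b → ZeroSum s b →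
         ZeroSumWalk s b c k → ZeroSumWalk s a c (suc k)

∷-differ : ∀ {A : Set} {m} x {a b : Vec A m} →
           DifferInExactlyTwo a b → DifferInExactlyTwo (x ∷ a) (x ∷ b)
∷-differ x {a} {b} (i , j , i≢j , iff) = suc i , suc j , (λ { refl → i≢j refl }) , iff′
  where
  iff′ : ∀ k → (lookup (x ∷ a) k ≢ lookup (x ∷ b) k) ⇔ (k ≡ suc i ⊎ k ≡ suc j)
  iff′ zero    = mk⇔ (contradiction refl) λ { (inj₁ ()) ; (inj₂ ()) }
  iff′ (suc k) = mk⇔
    ([ inj₁ ∘ cong suc , inj₂ ∘ cong suc ]′ ∘ Equivalence.to (iff k))
    λ { (inj₁ refl) → Equivalence.from (iff k) (inj₁ refl)
      ; (inj₂ refl) → Equivalence.from (iff k) (inj₂ refl) }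

∷-walk : ∀ {n m} s x {a b : Vec (Fin n) m} {k} →
         ZeroSumWalk (s + toℕ x) a b k → ZeroSumWalk s (x ∷ a) (x ∷ b) k
∷-walk s x []             = []
∷-walk s x (step {b = b} d z w) = step (∷-differ x d) (unshift s {a = b} z) (∷-walk s x w)

-- e is the number of steps saved out of ℓ.
Reach : ∀ {n m} (s : ℕ) (a b : Vec (Fin n) m) (e ℓ : ℕ) → Set
Reach s a b e ℓ = ∃[ k ] (ZeroSumWalk s a b k × k + e ≤ ℓ)

-- A genuine step forces `f ≢ t` by the hypothesis on `f ≡ t`, so it claims no saving; if a and b
-- coincide, the skipped step pays for a saving of at most 1.
reach-step : ∀ {n m} s {a b c : Vec (Fin n) m} {e ℓ} {f t : Fin n} i j → i ≢ j →
             ZeroSum s a → ZeroSum s b → AgreeOff i j a b →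
             (f ≡ t → lookup a i ≡ lookup b i) →
             Reach s b c e ℓ → Reach s a c (δ f t + e) (suc ℓ)
reach-step s {a} {b} {e = e} {f = f} {t} i j i≢j za zb agree null (k , w , bound)
  with agree-off-two s {a} {b} i j i≢j za zb agree
... | inj₂ (differ , aᵢ≢bᵢ) = suc k , step differ zb w ,
        subst (λ d → suc k + (d + e) ≤ _) (sym (δ-≢ (aᵢ≢bᵢ ∘ null))) (s≤s bound)
... | inj₁ refl = k , w , (begin
        k + (δ f t + e)   ≤⟨ +-monoʳ-≤ k (+-monoˡ-≤ e (δ≤1 f t)) ⟩
        k + suc e         ≡⟨ +-suc k e ⟩
        suc (k + e)       ≤⟨ s≤s bound ⟩
        suc _             ∎)
  where open ≤-Reasoning

-- The carry is pushed from left to right, turning a = x ∷ (as ∷ʳ t) into b; entry i is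
-- the value of t for which no carry crosses from coordinate i to coordinate i + 1.
cuts : ∀ {n p} .{{_ : NonZero n}} (s : ℕ) → Vec (Fin n) p → Vec (Fin n) (suc (suc p)) → Vec (Fin n) (suc p)
cuts s []       (x ∷ b) = neg (s + toℕ x + 0) ∷ []
cuts s (y ∷ as) (x ∷ b) = neg (s + toℕ x + σ (y ∷ as)) ∷ cuts (s + toℕ x) as b

-- At the cut value t, the target head y already has zero sum with the untouched tail, so the
-- current head x must equal it.
cut-null : ∀ {n p} .{{_ : NonZero n}} s {x y t : Fin n} (as : Vec (Fin n) p) →
           ZeroSum s (x ∷ (as ∷ʳ t)) → neg (s + toℕ y + σ as) ≡ t → x ≡ y
cut-null {n} s {x} {y} as za refl = head-determined s {a = as ∷ʳ t} za
  (unshift s {y} {as ∷ʳ t} (subst (n ∣_) eq (neg-∣ (s + toℕ y + σ as))))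
  where
  t = neg (s + toℕ y + σ as)
  eq : s + toℕ y + σ as + toℕ t ≡ s + toℕ y + σ (as ∷ʳ t)
  eq = trans (+-assoc (s + toℕ y) (σ as) (toℕ t)) (cong (s + toℕ y +_) (sym (σ-∷ʳ as t)))

complete : ∀ {n m} .{{_ : NonZero n}} s (as : Vec (Fin n) m) → ∃[ z ] ZeroSum s (z ∷ as)
complete {n} s as = z , subst (n ∣_) eq (neg-∣ (s + σ as))
  where
  z = neg (s + σ as)
  eq : s + σ as + toℕ z ≡ s + (toℕ z + σ as)
  eq = trans (+-assoc s (σ as) (toℕ z)) (cong (s +_) (+-comm (σ as) (toℕ z)))

hits : ∀ {n m} → Vec (Fin n) m → Fin n → ℕ
hits f t = sum (λ i → δ (lookup f i) t)

-- Each step gives the head its final value and lets its right neighbour absorb the carry. The list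
-- of cuts depends neither on x nor on t, so t can be chosen afterwards.
carry-reach : ∀ {n p} .{{_ : NonZero n}} s x (as : Vec (Fin n) p) t b →
              ZeroSum s (x ∷ (as ∷ʳ t)) → ZeroSum s b →
              Reach s (x ∷ (as ∷ʳ t)) b (hits (cuts s as b) t) (suc p)
carry-reach s x [] t b@(x′ ∷ z ∷ []) za zb =
  reach-step s zero (suc zero) (λ ()) za zb
    (λ { zero k≢0 _ → contradiction refl k≢0
       ; (suc zero) _ k≢1 → contradiction refl k≢1
       ; (suc (suc ())) })
    (cut-null s [] za) (0 , [] , z≤n)
carry-reach s x (y ∷ as) t (x′ ∷ b) za zb with complete (s + toℕ x′) (as ∷ʳ t)
... | y′ , zy′ with carry-reach (s + toℕ x′) y′ as t b zy′ (shift s {a = b} zb)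
... | k , w , bound =
  reach-step s zero (suc zero) (λ ()) za (unshift s {a = y′ ∷ (as ∷ʳ t)} zy′)
    (λ { zero k≢0 _ → contradiction refl k≢0
       ; (suc zero) _ k≢1 → contradiction refl k≢1
       ; (suc (suc k)) _ _ → refl })
    (cut-null s (y ∷ as) za) (k , ∷-walk s x′ w , bound)

∷ʳ-agree : ∀ {A : Set} {p} (as : Vec A p) x y k → k ≢ fromℕ p → lookup (as ∷ʳ x) k ≡ lookup (as ∷ʳ y) k
∷ʳ-agree []       x y zero    k≢0 = contradiction refl k≢0
∷ʳ-agree (z ∷ as) x y zero    k≢p = refl
∷ʳ-agree (z ∷ as) x y (suc k) k≢p = ∷ʳ-agree as x y k (k≢p ∘ cong suc)

lookup-∷ʳ-last : ∀ {A : Set} {p} (as : Vec A p) x → lookup (as ∷ʳ x) (fromℕ p) ≡ x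
lookup-∷ʳ-last []       x = refl
lookup-∷ʳ-last (z ∷ as) x = lookup-∷ʳ-last as x

-- Carries run around the cycle of coordinates; t is the value of the last coordinate
-- after a carry across the edge from it to coordinate 0.
cyclic-reach : ∀ {n p} .{{_ : NonZero n}} (a b : Vec (Fin n) (suc p)) → ZeroSum 0 a → ZeroSum 0 b →
               ∃[ f ] (∀ t → Reach 0 a b (hits {n} {suc p} f t) (suc p))
-- With one coordinate a and b coincide, and the empty walk saves the single allotted step for any
-- cut value.
cyclic-reach {n} {zero} (x ∷ []) (y ∷ []) za zb
  with refl ← head-determined 0 {a = []} za zb =
  x ∷ [] , λ t → 0 , [] , subst (_≤ 1) (sym (+-identityʳ (δ x t))) (δ≤1 x t)
cyclic-reach {n} {suc p} (x ∷ a) b za zb with initLast a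
-- The wrap-around edge has cut value l: for `t ≡ l` the last coordinate is left unchanged.
... | as , l , refl = l ∷ cuts 0 as b , λ t → reach t (complete 0 (as ∷ʳ t))
  where
  reach : ∀ t → ∃[ z ] ZeroSum 0 (z ∷ (as ∷ʳ t)) →
          Reach 0 (x ∷ (as ∷ʳ l)) b (hits (l ∷ cuts 0 as b) t) (suc (suc p))
  reach t (z , zz) = reach-step 0 {f = l} (suc (fromℕ p)) zero (λ ()) za zz
    (λ { zero _ k≢0 → contradiction refl k≢0
       ; (suc k) k≢p _ → ∷ʳ-agree as l t k (k≢p ∘ cong suc) })
    (λ l≡t → trans (lookup-∷ʳ-last as l) (trans l≡t (sym (lookup-∷ʳ-last as t))))
    (carry-reach 0 z as t b zz zb)

diam : ℕ → (n : ℕ) → .{{_ : NonZero n}} → ℕ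
diam m n = m ∸ (m ∸ 1) / n ∸ 1

short-walk : ∀ {n p} .{{_ : NonZero n}} (a b : Vec (Fin n) (suc p)) → ZeroSum 0 a → ZeroSum 0 b →
             ∃[ k ] (ZeroSumWalk 0 a b k × k ≤ diam (suc p) n)
short-walk {n} {p} a b za zb with cyclic-reach a b za zb
... | f , reach with large-fibre (lookup f)
... | t , large with reach t
... | k , w , bound = k , w , (begin
  k                      ≤⟨ m+n≤o⇒m≤o∸n k bound ⟩
  -- `large` reads `p < hits f t * n`, so at least `suc (p / n)` steps are saved.
  suc p ∸ hits f t       ≤⟨ ∸-monoʳ-≤ (suc p) (m<n*o⇒m/o<n {p} {hits f t} large) ⟩
  suc p ∸ suc (p / n)    ≡⟨ cong (suc p ∸_) (+-comm 1 (p / n)) ⟩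
  suc p ∸ (p / n + 1)    ≡⟨ ∸-+-assoc (suc p) (p / n) 1 ⟨
  suc p ∸ p / n ∸ 1      ∎)
  where open ≤-Reasoning

toWalk : ∀ {n m} {a b : Vec (Fin n) m} {k} .(za : ZeroSum 0 a) .(zb : ZeroSum 0 b) →
         ZeroSumWalk 0 a b k → Walk (CSR m n) (a , [ za ]) (b , [ zb ]) k
toWalk za zb []            = []
toWalk za zb (step d z w) = d ∷ toWalk z zb w

-- The irrelevant proof is recovered by deciding divisibility.
vertex-sum : ∀ {m n} (u : CSRVertex m n) → n ∣ σ (value u)
vertex-sum {n = n} (a , [ z ]) = recompute (n ∣? σ a) z

-- Distances

differ? : ∀ {n m} (a b : Vec (Fin n) m) → Dec (DifferInExactlyTwo a b)
differ? a b = any? λ i → any? λ j → ¬? (i ≟ j) ×-dec all? λ k →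
  map′ (λ (to , from) → mk⇔ to from) (λ e → Equivalence.to e , Equivalence.from e)
    ((¬? (lookup a k ≟ lookup b k) →-dec (k ≟ i ⊎-dec k ≟ j)) ×-dec
     ((k ≟ i ⊎-dec k ≟ j) →-dec ¬? (lookup a k ≟ lookup b k)))

any-vec? : ∀ {n} m {P : Vec (Fin n) m → Set} → Decidable P → Dec (∃ P)
any-vec? zero    P? = map′ ([] ,_) (λ { ([] , p) → p }) (P? [])
any-vec? (suc m) P? = map′ (λ (x , a , p) → x ∷ a , p) (λ { (x ∷ a , p) → x , a , p })
  (any? λ x → any-vec? m (P? ∘ (x ∷_)))

any-vertex? : ∀ {m n} {P : CSRVertex m n → Set} → Decidable P → Dec (∃ P)
any-vertex? {m} {n} {P} P? =
  map′ (λ (a , z , p) → (a , [ z ]) , p) (λ (u , p) → value u , vertex-sum u , p) (any-vec? m Q?)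
  where
  Q : Vec (Fin n) m → Set
  Q a = ∃[ z ] P (a , [ z ])
  Q? : Decidable Q
  Q? a with n ∣? σ a
  ... | yes z = map′ (z ,_) proj₂ (P? (a , [ z ]))
  ... | no ¬z = no (¬z ∘ proj₁)

-- There are finitely many candidates for the next vertex. Decidability lets `least` turn any walk
-- into a distance.
walk? : ∀ {m n} (u v : CSRVertex m n) k → Dec (Walk (CSR m n) u v k)
walk? u v zero    = map′ (λ { refl → [] }) (λ { [] → refl }) (refinement-≟ (≡-dec _≟_) u v)
walk? u v (suc k) = map′ (λ (_ , d , w) → d ∷ w) (λ { (d ∷ w) → _ , d , w })
  (any-vertex? λ x → differ? (value u) (value x) ×-dec walk? x v k)

least : ∀ {P : ℕ → Set} → Decidable P → ∀ k → P k → ∃[ d ] (P d × (∀ j → P j → d ≤ j))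
least P? zero    p = 0 , p , λ _ _ → z≤n
least P? (suc k) p with P? 0
... | yes p₀ = 0 , p₀ , λ _ _ → z≤n
... | no ¬p₀ with least (P? ∘ suc) k p
... | d , pd , minimal = suc d , pd , λ
  { zero p₀ → contradiction p₀ ¬p₀ ; (suc j) pj → s≤s (minimal j pj) }

-- The lower bound

weighted : ∀ {n m} → (Fin m → ℕ) → Vec (Fin n) m → ℕ
weighted ψ a = sum (λ k → ψ k * toℕ (lookup a k))

weighted-const : ∀ {n m} x (a : Vec (Fin n) m) → weighted (λ _ → x) a ≡ x * σ a
weighted-const x []      = sym (*-zeroʳ x)
weighted-const x (y ∷ a) = trans (cong (x * toℕ y +_) (weighted-const x a)) (sym (*-distribˡ-+ x (toℕ y) (σ a)))

-- A subtraction-free form of the fact that each product of `ψ k - ψ i` with the difference of a and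
-- b at k vanishes.
weighted-exchange : ∀ {n m} (ψ : Fin m → ℕ) {i j} {a b : Vec (Fin n) m} → ψ i ≡ ψ j → AgreeOff i j a b →
                    weighted ψ a + ψ i * σ b ≡ weighted ψ b + ψ i * σ a
weighted-exchange ψ {i} {j} {a} {b} ψᵢ≡ψⱼ agree = begin
  weighted ψ a + ψ i * σ b                         ≡⟨ cong (weighted ψ a +_) (weighted-const (ψ i) b) ⟨
  weighted ψ a + weighted (λ _ → ψ i) b            ≡⟨ ∑-distrib-+ (term ψ a) (term (λ _ → ψ i) b) ⟨
  sum (λ k → ψ k * toℕ (lookup a k) + ψ i * toℕ (lookup b k)) ≡⟨ sum-cong-≗ swap ⟩
  sum (λ k → ψ k * toℕ (lookup b k) + ψ i * toℕ (lookup a k)) ≡⟨ ∑-distrib-+ (term ψ b) (term (λ _ → ψ i) a) ⟩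
  weighted ψ b + weighted (λ _ → ψ i) a            ≡⟨ cong (weighted ψ b +_) (weighted-const (ψ i) a) ⟩
  weighted ψ b + ψ i * σ a                         ∎
  where
  open ≡-Reasoning
  term : (Fin _ → ℕ) → Vec (Fin _) _ → Fin _ → ℕ
  term ψ a k = ψ k * toℕ (lookup a k)
  swap : ∀ k → ψ k * toℕ (lookup a k) + ψ i * toℕ (lookup b k) ≡ ψ k * toℕ (lookup b k) + ψ i * toℕ (lookup a k)
  swap k with k ≟ i | k ≟ j
  ... | yes refl | _        = +-comm (ψ k * toℕ (lookup a k)) _
  ... | no _     | yes refl rewrite ψᵢ≡ψⱼ = +-comm (ψ k * toℕ (lookup a k)) _
  ... | no k≢i   | no k≢j   rewrite agree k k≢i k≢j = refl

-- In `weighted-exchange` the terms `ψ i * σ` vanish modulo n, because u and w are vertices.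
weighted-step : ∀ {m n} {u w : CSRVertex m n} (ψ : Fin m → ℕ) {i j} → ψ i ≡ ψ j → AgreeOff i j (value u) (value w) →
                n ∣ weighted ψ (value u) → n ∣ weighted ψ (value w)
weighted-step {n = n} {u} {w} ψ {i} ψᵢ≡ψⱼ agree n∣u =
  ∣m+n∣m⇒∣n
    (subst (n ∣_) (trans (weighted-exchange ψ {a = value u} {value w} ψᵢ≡ψⱼ agree) (+-comm (weighted ψ (value w)) _))
      (∣m∣n⇒∣m+n n∣u (∣n⇒∣m*n (ψ i) (vertex-sum w))))
    (∣n⇒∣m*n (ψ i) (vertex-sum u))

differ-agree : ∀ {n m} (a b : Vec (Fin n) m) (d : DifferInExactlyTwo a b) →
               AgreeOff (proj₁ d) (proj₁ (proj₂ d)) a b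
differ-agree a b (i , j , _ , iff) k k≢i k≢j with lookup a k ≟ lookup b k
... | yes eq = eq
... | no ≢   = contradiction (Equivalence.to (iff k) ≢) [ k≢i , k≢j ]′

-- Removes q, sending it to the new name of p.
merge : ∀ {r} {p q : Fin (suc r)} → q ≢ p → Fin (suc r) → Fin r
merge {q = q} q≢p x with q ≟ x
... | yes _   = punchOut q≢p
... | no  q≢x = punchOut q≢x

merge-identifies : ∀ {r} {p q : Fin (suc r)} (q≢p : q ≢ p) → merge q≢p p ≡ merge q≢p q
merge-identifies {p = p} {q} q≢p with q ≟ p | q ≟ q
... | yes q≡p | _       = contradiction q≡p q≢p
... | no _    | yes _   = punchOut-cong q refl
... | no _    | no q≢q  = contradiction refl q≢q

merge-surjection : ∀ {r} {p q : Fin (suc r)} (q≢p : q ≢ p) → StrictlySurjective _≡_ (merge q≢p)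
merge-surjection {q = q} q≢p y = punchIn q y , eq
  where
  eq : merge q≢p (punchIn q y) ≡ y
  eq with q ≟ punchIn q y
  ... | yes q≡ = contradiction (sym q≡) (punchInᵢ≢i q y)
  ... | no  q≢ = trans (punchOut-cong q refl) (punchOut-punchIn q)

-- The colour classes are the connected components of the graph on the coordinates whose
-- edges are the pairs changed by the steps; the sum over each class stays constant mod n.
Colouring : ∀ {n m} (a b : Vec (Fin n) m) (k r : ℕ) → Set
Colouring {n} {m} a b k r = ∃ λ (c : Fin m → Fin r) → (StrictlySurjective _≡_ c × m ≤ r + k ×
  (∀ (φ : Fin r → ℕ) → n ∣ weighted (φ ∘ c) a → n ∣ weighted (φ ∘ c) b))

-- Built from the end of the walk: each earlier step lies inside one class or merges two, so it
-- costs at most one colour.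
walk-colouring : ∀ {m n} {u v : CSRVertex m n} {k} → Walk (CSR m n) u v k →
                 ∃ (Colouring (value u) (value v) k)
walk-colouring {m} [] = m , (λ i → i) , (λ q → q , refl) , m≤m+n m 0 , λ φ n∣ → n∣
walk-colouring {m} {n} {u} {v} {suc k} (_∷_ {v = w} differ@(i , j , _) walk) with walk-colouring walk
... | zero , c , _ = case c i of λ ()
... | suc r , c , surj , bound , preserve with c j ≟ c i
... | yes cⱼ≡cᵢ = suc r , c , surj , ≤-trans bound (+-monoʳ-≤ (suc r) (n≤1+n k)) ,
        λ φ → preserve φ ∘ weighted-step {u = u} {w} (φ ∘ c) (cong φ (sym cⱼ≡cᵢ)) (differ-agree (value u) (value w) differ)
... | no cⱼ≢cᵢ = r , c′ , surj′ , ≤-trans bound (≤-reflexive (sym (+-suc r k))) ,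
        λ φ → preserve (φ ∘ merge cⱼ≢cᵢ) ∘
              weighted-step {u = u} {w} (φ ∘ c′) (cong φ (merge-identifies cⱼ≢cᵢ)) (differ-agree (value u) (value w) differ)
  where
  c′ : Fin m → Fin r
  c′ = merge cⱼ≢cᵢ ∘ c
  surj′ : StrictlySurjective _≡_ c′
  surj′ q with merge-surjection cⱼ≢cᵢ q
  ... | p , refl with surj p
  ...   | x , refl = x , refl

-- An extremal pair and the diameter

σ-replicate : ∀ {n} m (x : Fin n) → σ (replicate m x) ≡ m * toℕ x
σ-replicate zero    x = refl
σ-replicate (suc m) x = cong (toℕ x +_) (σ-replicate m x)

origin : ∀ m n → CSRVertex m (suc n)
origin m n = replicate m zero , [ subst (suc n ∣_) (sym (trans (σ-replicate m zero) (*-zeroʳ m))) (suc n ∣0) ]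

-- In (z , 1 , … , 1) a zero-sum set of coordinates avoiding the first has at least n
-- elements.
colours-bound : ∀ {n k r p} {z : Fin (suc (suc n))} →
                Colouring (replicate (suc p) zero) (z ∷ replicate p (suc zero)) k r →
                r * suc (suc n) ≤ p + suc (suc n)
colours-bound {n} {k} {r} {p} {z} (c , surj , _ , preserve) = begin
  r * m                                     ≡⟨ sum-const r m ⟨
  -- Here m is the modulus. The colour of coordinate 0 is granted m by the δ term, as its class may
  -- be small.
  sum {r} (λ _ → m)                         ≤⟨ sum-mono-≤ large ⟩
  sum (λ q → size q + m * δ (c zero) q)     ≡⟨ ∑-distrib-+ size (λ q → m * δ (c zero) q) ⟩
  sum size + sum (λ q → m * δ (c zero) q)   ≡⟨ cong₂ _+_ (sum-fibres (c ∘ suc)) (sym (*-distribˡ-sum m (δ (c zero)))) ⟩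
  p + m * sum (δ (c zero))                  ≡⟨ cong (λ x → p + m * x) (sum-δ (c zero)) ⟩
  p + m * 1                                 ≡⟨ cong (p +_) (*-identityʳ m) ⟩
  p + m                                     ∎
  where
  open ≤-Reasoning
  m = suc (suc n)
  size : Fin r → ℕ
  size q = sum (λ i → δ (c (suc i)) q)

  zero-sum : ∀ q → m ∣ weighted (λ i → δ (c i) q) (z ∷ replicate p (suc zero))
  zero-sum q = preserve (λ x → δ x q) (subst (m ∣_) (sym weight-zero) (m ∣0))
    where
    weight-zero : weighted (λ i → δ (c i) q) (replicate (suc p) zero) ≡ 0
    weight-zero = trans (sum-cong-≗ {suc p} λ i →
        trans (cong (λ x → δ (c i) q * toℕ x) (lookup-replicate i (zero {suc n}))) (*-zeroʳ (δ (c i) q)))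
      (trans (sum-const (suc p) 0) (*-zeroʳ (suc p)))

  weight : ∀ q → c zero ≢ q → weighted (λ i → δ (c i) q) (z ∷ replicate p (suc zero)) ≡ size q
  weight q c₀≢q = cong₂ _+_ (cong (_* toℕ z) (δ-≢ c₀≢q)) (sum-cong-≗ λ i →
    trans (cong (λ x → δ (c (suc i)) q * toℕ x) (lookup-replicate i (suc zero))) (*-identityʳ _))

  positive : ∀ q → c zero ≢ q → 0 < size q
  positive q c₀≢q with surj q
  ... | zero  , c₀≡q = contradiction c₀≡q c₀≢q
  ... | suc i , cᵢ≡q = subst (_≤ size q) (δ-≡ cᵢ≡q) (term≤sum (λ i → δ (c (suc i)) q) i)

  large : ∀ q → m ≤ size q + m * δ (c zero) q
  large q with c zero ≟ q
  ... | yes c₀≡q = begin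
    m                             ≡⟨ *-identityʳ m ⟨
    m * 1                         ≤⟨ m≤n+m (m * 1) (size q) ⟩
    size q + m * 1                ∎
  -- All entries of this class are 1, so its size is a multiple of m, positive by surjectivity.
  ... | no  c₀≢q = ≤-trans
    (∣⇒≤ {{>-nonZero (positive q c₀≢q)}} (subst (m ∣_) (weight q c₀≢q) (zero-sum q)))
    (m≤m+n (size q) _)

far-apart : ∀ p n → ∃[ u ] ∃[ v ] (∀ k → Walk (CSR (suc p) (suc n)) u v k → diam (suc p) (suc n) ≤ k)
-- Modulo 1 there is no residue `suc zero`, but the claimed diameter is 0 and any pair will do.
far-apart p zero = origin (suc p) 0 , origin (suc p) 0 , λ k _ → subst (_≤ k) (sym diam≡0) z≤n
  where
  diam≡0 : diam (suc p) 1 ≡ 0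
  diam≡0 = trans (cong (λ x → suc p ∸ x ∸ 1) (n/1≡n p)) (cong (_∸ 1) (m+n∸n≡m 1 p))
far-apart p (suc n) with complete {suc (suc n)} 0 (replicate p (suc zero))
... | z , zero-sum = origin (suc p) (suc n) , (z ∷ replicate p (suc zero) , [ zero-sum ]) , bound
  where
  N = suc (suc n)
  bound : ∀ k → Walk (CSR (suc p) N) _ _ k → diam (suc p) N ≤ k
  bound k w with walk-colouring w
  ... | zero  , c , _ = case c zero of λ ()
  ... | suc r , colouring@(_ , _ , m≤r+k , _) = begin
    suc p ∸ p / N ∸ 1     ≡⟨ ∸-+-assoc (suc p) (p / N) 1 ⟩
    suc p ∸ (p / N + 1)   ≡⟨ cong (suc p ∸_) (+-comm (p / N) 1) ⟩
    p ∸ p / N             ≤⟨ ∸-monoʳ-≤ p r≤p/N ⟩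
    suc p ∸ suc r         ≤⟨ m≤n+o⇒m∸n≤o (suc p) (suc r) m≤r+k ⟩
    k                     ∎
    where
    open ≤-Reasoning
    r≤p/N : r ≤ p / N
    r≤p/N = begin
      r            ≡⟨ m*n/n≡m r N ⟨
      -- One N, granted to the colour of coordinate 0, cancels from `suc r * N ≤ p + N`.
      r * N / N    ≤⟨ /-monoˡ-≤ N (+-cancelˡ-≤ N (r * N) p (≤-trans (colours-bound colouring) (≤-reflexive (+-comm p N)))) ⟩
      p / N        ∎

theorem5 : ∀ (m n : ℕ) .{{_ : NonZero m}} .{{_ : NonZero n}} →
    IsDiameter (CSR m n) (m ∸ (m ∸ 1) / n ∸ 1)
theorem5 (suc p) (suc n) = distances , extremal (far-apart p n)
  where
  G = CSR (suc p) (suc n)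
  D = diam (suc p) (suc n)

  walk : ∀ u v → ∃[ k ] (Walk G u v k × k ≤ D)
  walk u@(a , [ za ]) v@(b , [ zb ]) with short-walk a b (vertex-sum u) (vertex-sum v)
  ... | k , w , k≤D = k , toWalk za zb w , k≤D

  distances : ∀ u v → ∃[ d ] (IsDistance G u v d × d ≤ D)
  distances u v with walk u v
  ... | k , w , k≤D with least (walk? u v) k w
  ... | d , shortest , minimal = d , (shortest , minimal) , ≤-trans (minimal k w) k≤D

  extremal : ∃[ u ] ∃[ v ] (∀ k → Walk G u v k → D ≤ k) → ∃[ u ] ∃[ v ] IsDistance G u v D
  extremal (u , v , minimal) with walk u v
  ... | k , w , k≤D = u , v , subst (Walk G u v) (≤-antisym k≤D (minimal k w)) w , minimal
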